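{- For every countable ordinal $\gamma$, the class $\mathcal{L}_{\preceq\mathbb{Z}^\gamma}$ of all (nonempty) linear orders that embed into $\mathbb{Z}^\gamma$ is ccs.
   Context: $L\preceq L'$ means there is an embedding $f:L\to L'$ of linear orders, i.e. $x\le_L y\iff f(x)\le_{L'}f(y)$. $\mathcal{L}_{\preceq L_0}=\{L: L\preceq L_0\}$, where $L$ ranges over nonempty linear orders (up to isomorphism). For an ordinal $\gamma$, $\mathbb{Z}^\gamma$ is the linear order on the set of functions $f:\gamma\to\mathbb{Z}$ with finite support $\mathrm{Supp}(f)=\{\beta<\gamma: f(\beta)\ne0\}$, where $f\le g$ iff $f=g$ or $f(\beta_0)<g(\beta_0)$ for $\beta_0=\max\{\beta\in\mathrm{Supp}(f)\cup\mathrm{Supp}(g): f(\beta)\ne g(\beta)\}$. Equivalently, $\mathbb{Z}^0=\mathbf{1}$ is the one-point order, $\mathbb{Z}^{\gamma+1}=(\mathbb{Z}^\gamma\omega)^*+\mathbb{Z}^\gamma+\mathbb{Z}^\gamma\omega$, and $\mathbb{Z}^\gamma=(\sum_{\beta<\gamma}\mathbb{Z}^\beta\omega)^*+\mathbf{1}+\sum_{\beta<\gamma}\mathbb{Z}^\beta\omega$ for limit $\gamma$ (here $LK$ is $L\times K$ ordered antilexicographically and $*$ denotes the reverse order). A subset $I$ of a linear order $L$ is convex if $x\le_L y\le_L z$ and $x,z\in I$ imply $y\in I$. For $A,B\subseteq L$ write $A\le_L B$ if $a\le_L b$ for all $a\in A$, $b\in B$. A class $\mathcal{L}$ of linear orders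 closed downward under $\preceq$ is ccs (closed under convex sums) if for all $K,K'\in\mathcal{L}$ and every family $(K'_k)_{k\in K}$ of nonempty convex subsets of $K'$ such that $k_0<_K k_1\Rightarrow K'_{k_0}\le_{K'}K'_{k_1}$ for all $k_0,k_1\in K$, we have $\sum_{k\in K}K'_k\in\mathcal{L}$, where $\sum_{k\in K}K'_k=\{(x,k): k\in K, x\in K'_k\}$ ordered antilexicographically. -}

module Defs where

open import Data.Empty using (⊥-elim)
open import Data.Integer.Base using (ℤ; 0ℤ) renaming (_<_ to _<ℤ_)
import Data.Integer.Properties as ℤ
open import Data.List.Base using (List; []; _∷_; _++_)
open import Data.List.Relation.Unary.Any using (here; there)
import Data.List.Membership.Setoid as Membership
open import Data.List.Membership.Setoid.Properties using (∈-++⁺ˡ; ∈-++⁺ʳ)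
open import Data.Nat.Base using (ℕ)
open import Data.Product.Base using (Σ; ∃; _×_; _,_; proj₁; proj₂; swap)
import Data.Product.Relation.Binary.Lex.NonStrict as Lex
open import Data.Sum.Base using (_⊎_; inj₁; inj₂)
open import Function.Base using (_∘_)
open import Function.Bundles using (Injection; _⇔_)
open import Level using (Level; _⊔_) renaming (suc to lsuc)
open import Induction.WellFounded using (WellFounded)
open import Relation.Binary.Bundles using (DecTotalOrder)
open import Relation.Binary.Core using (Rel)
open import Relation.Binary.Definitions
  using (Transitive; Trichotomous; Irreflexive; tri<; tri≈; tri>)
open import Relation.Binary.Structures
  using (IsEquivalence; IsStrictTotalOrder; IsDecTotalOrder)
open import Relation.Binary.Structures.Biased using (isStrictTotalOrderᶜ)
import Relation.Binary.Construct.On as On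
import Relation.Binary.Construct.StrictToNonStrict as ToNonStrict
import Relation.Binary.Properties.DecTotalOrder as DTO
open import Relation.Binary.PropositionalEquality
  using (_≡_; _≢_; refl; sym; trans; subst; subst₂; setoid)
open import Relation.Nullary using (¬_; yes; no; ¬?)
open import Relation.Unary using (Pred; _∈_; _⊆_; _≐_; _∪_; Satisfiable; Decidable)

private variable
  a b c ℓ p : Level

-- A nonempty linear order. The order relation is decidable, as it is
-- classically for every total order; its equality is a setoid equality, so
-- that subsets of a linear order are again linear orders.
record LinearOrder a b c : Set (lsuc (a ⊔ b ⊔ c)) where
  field
    decTotalOrder : DecTotalOrder a b c
  open DecTotalOrder decTotalOrder public
  open DTO decTotalOrder public using (_<_)
  field
    point : Carrier

-- Ordinals are represented by well-orders; the empty one is the ordinal 0.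
record Ordinal a b c : Set (lsuc (a ⊔ b ⊔ c)) where
  field
    decTotalOrder : DecTotalOrder a b c
  open DTO decTotalOrder using (_<_)
  field
    <-wellFounded : WellFounded _<_

Countable : Ordinal a b c → Set _
Countable γ = Injection (DecTotalOrder.Eq.setoid decTotalOrder) (setoid ℕ)
  where open Ordinal γ

infix 4 _≼_

_≼_ : ∀ {a b c a′ b′ c′} → LinearOrder a b c → LinearOrder a′ b′ c′ → Set _
L ≼ L′ = ∃ λ (f : L.Carrier → L′.Carrier) → ∀ x y → x L.≤ y ⇔ f x L′.≤ f y
  where module L = LinearOrder L
        module L′ = LinearOrder L′

𝓛≼ : LinearOrder a b c → Pred (LinearOrder ℓ ℓ ℓ) _
𝓛≼ L₀ L = L ≼ L₀

module _ (L : LinearOrder a b c) where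
  open LinearOrder L

  Convex : Pred Carrier p → Set _
  Convex I = ∀ {x y z} → x ≤ y → y ≤ z → x ∈ I → z ∈ I → y ∈ I

  SetLeq : Pred Carrier p → Pred Carrier p → Set _
  SetLeq A B = ∀ {x y} → x ∈ A → y ∈ B → x ≤ y

record ConvexFamily (K K′ : LinearOrder ℓ ℓ ℓ) : Set (lsuc ℓ) where
  private module K = LinearOrder K
          module K′ = LinearOrder K′
  field
    part       : K.Carrier → Pred K′.Carrier ℓ
    part-cong  : ∀ {k₀ k₁} → k₀ K.≈ k₁ → part k₀ ≐ part k₁
    nonempty   : ∀ k → Satisfiable (part k)
    convex     : ∀ k → Convex K′ (part k)
    increasing : ∀ {k₀ k₁} → k₀ K.< k₁ → SetLeq K′ (part k₀) (part k₁)

-- Lex.×-decTotalOrder gives priority to the first coordinate, hence the swap.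
convexSum : (K K′ : LinearOrder ℓ ℓ ℓ) → ConvexFamily K K′ → LinearOrder ℓ ℓ ℓ
convexSum K K′ F = record
  { decTotalOrder = On.decTotalOrder
      (Lex.×-decTotalOrder K.decTotalOrder K′.decTotalOrder)
      (λ (s : Σ (K′.Carrier × K.Carrier) λ (x , k) → x ∈ part k) → swap (proj₁ s))
  ; point = (proj₁ (nonempty K.point) , K.point) , proj₂ (nonempty K.point)
  }
  where module K = LinearOrder K
        module K′ = LinearOrder K′
        open ConvexFamily F

record IsCCS (𝓛 : Pred (LinearOrder ℓ ℓ ℓ) p) : Set (lsuc ℓ ⊔ p) where
  field
    downward : ∀ {L L′} → L ≼ L′ → L′ ∈ 𝓛 → L ∈ 𝓛
    sums     : ∀ {K K′} → K ∈ 𝓛 → K′ ∈ 𝓛 →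
               (F : ConvexFamily K K′) → convexSum K K′ F ∈ 𝓛

module Power (γ : Ordinal a b c) where
  private module γ = DecTotalOrder (Ordinal.decTotalOrder γ)
  open Membership γ.Eq.setoid using () renaming (_∈_ to _∈ᴸ_)

  record FinSupp : Set (a ⊔ b) where
    field
      fun      : γ.Carrier → ℤ
      fun-cong : ∀ {α β} → α γ.≈ β → fun α ≡ fun β

    Supp : Pred γ.Carrier _
    Supp β = fun β ≢ 0ℤ

    field
      finite : ∃ λ (βs : List γ.Carrier) → Supp ⊆ (_∈ᴸ βs)

  open FinSupp public

  infix 4 _≈_ _≺_ _≤_

  _≈_ : Rel FinSupp _
  f ≈ g = ∀ β → fun f β ≡ fun g β

  Diff : FinSupp → FinSupp → Pred γ.Carrier _
  Diff f g β = β ∈ Supp f ∪ Supp g × fun f β ≢ fun g β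

  IsMax : Pred γ.Carrier p → γ.Carrier → Set _
  IsMax S m = m ∈ S × (∀ {β} → β ∈ S → β γ.≤ m)

  _≺_ : Rel FinSupp _
  f ≺ g = ∃ λ β₀ → IsMax (Diff f g) β₀ × fun f β₀ <ℤ fun g β₀

  _≤_ : Rel FinSupp _
  f ≤ g = f ≺ g ⊎ f ≈ g

  -- Two integers that differ cannot both vanish, so the condition on the
  -- supports in Diff is automatic.
  differ : ∀ f g {β} → fun f β ≢ fun g β → β ∈ Diff f g
  differ f g {β} f≢g with fun f β ℤ.≟ 0ℤ
  ... | no  fβ≢0 = inj₁ fβ≢0 , f≢g
  ... | yes fβ≡0 = inj₂ (λ gβ≡0 → f≢g (trans fβ≡0 (sym gβ≡0))) , f≢g

  agree : ∀ f g {m β} → IsMax (Diff f g) m → ¬ (β γ.≤ m) → fun f β ≡ fun g β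
  agree f g {β = β} (_ , max) β≰m with fun f β ℤ.≟ fun g β
  ... | yes eq = eq
  ... | no neq = ⊥-elim (β≰m (max (differ f g neq)))

  maxIn : (S : Pred γ.Carrier p) → Decidable S →
          (∀ {α β} → α γ.≈ β → α ∈ S → β ∈ S) → ∀ βs →
          (∃ λ m → m ∈ S × (∀ {β} → β ∈ᴸ βs → β ∈ S → β γ.≤ m)) ⊎
          (∀ {β} → β ∈ᴸ βs → ¬ (β ∈ S))
  maxIn S S? resp [] = inj₂ λ ()
  maxIn S S? resp (α ∷ βs) with S? α | maxIn S S? resp βs
  ... | no α∉S | inj₂ none = inj₂ λ
    { (here β≈α) β∈S → α∉S (resp β≈α β∈S) ; (there β∈) → none β∈ }
  ... | no α∉S | inj₁ (m , m∈S , max) = inj₁ (m , m∈S , λ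
    { (here β≈α) β∈S → ⊥-elim (α∉S (resp β≈α β∈S)) ; (there β∈) → max β∈ })
  ... | yes α∈S | inj₂ none = inj₁ (α , α∈S , λ
    { (here β≈α) _ → γ.reflexive β≈α ; (there β∈) β∈S → ⊥-elim (none β∈ β∈S) })
  ... | yes α∈S | inj₁ (m , m∈S , max) with γ.total α m
  ...   | inj₁ α≤m = inj₁ (m , m∈S , λ
    { (here β≈α) _ → γ.trans (γ.reflexive β≈α) α≤m ; (there β∈) → max β∈ })
  ...   | inj₂ m≤α = inj₁ (α , α∈S , λ
    { (here β≈α) _ → γ.reflexive β≈α
    ; (there β∈) β∈S → γ.trans (max β∈ β∈S) m≤α })

  maxDiff : ∀ f g → (∃ λ m → IsMax (Diff f g) m) ⊎ f ≈ g
  maxDiff f g = result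
    where
    βs = proj₁ (finite f) ++ proj₁ (finite g)

    resp : ∀ {α β} → α γ.≈ β → fun f α ≢ fun g α → fun f β ≢ fun g β
    resp α≈β neq eq =
      neq (trans (fun-cong f α≈β) (trans eq (sym (fun-cong g α≈β))))

    listed : ∀ {β} → β ∈ Diff f g → β ∈ᴸ βs
    listed (inj₁ f≢0 , _) = ∈-++⁺ˡ γ.Eq.setoid (proj₂ (finite f) f≢0)
    listed (inj₂ g≢0 , _) =
      ∈-++⁺ʳ γ.Eq.setoid (proj₁ (finite f)) (proj₂ (finite g) g≢0)

    result : (∃ λ m → IsMax (Diff f g) m) ⊎ f ≈ g
    result with maxIn (λ β → fun f β ≢ fun g β)
                      (λ β → ¬? (fun f β ℤ.≟ fun g β)) resp βs
    ... | inj₁ (m , neq , max) =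
      inj₁ (m , differ f g neq , λ d → max (listed d) (proj₂ d))
    ... | inj₂ none = inj₂ eq
      where
      eq : f ≈ g
      eq β with fun f β ℤ.≟ fun g β
      ... | yes e = e
      ... | no ne = ⊥-elim (none (listed (differ f g ne)) ne)

  isMax-sym : ∀ {f g m} → IsMax (Diff f g) m → IsMax (Diff g f) m
  isMax-sym {f} {g} ((_ , ne) , max) =
    differ g f (ne ∘ sym) , λ (_ , ne′) → max (differ f g (ne′ ∘ sym))

  ≈-isEquivalence : IsEquivalence _≈_
  ≈-isEquivalence = record
    { refl  = λ _ → refl
    ; sym   = λ e β → sym (e β)
    ; trans = λ e e′ β → trans (e β) (e′ β)
    }

  ≺-irrefl : Irreflexive _≈_ _≺_
  ≺-irrefl f≈g (β , ((_ , ne) , _) , _) = ne (f≈g β)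

  ≺-trans : Transitive _≺_
  ≺-trans {f} {g} {h} (m , M@(_ , max) , f<g) (n , N@(_ , max′) , g<h) = go
    where
    build : ∀ k → fun f k <ℤ fun h k → m γ.≤ k → n γ.≤ k → f ≺ h
    build k f<h m≤k n≤k =
      k , (differ f h (ℤ.<⇒≢ f<h) , bound) , f<h
      where
      bound : ∀ {β} → β ∈ Diff f h → β γ.≤ k
      bound {β} (_ , ne) with fun f β ℤ.≟ fun g β
      ... | no ne₁ = γ.trans (max (differ f g ne₁)) m≤k
      ... | yes e₁ = γ.trans (max′ (differ g h λ e₂ → ne (trans e₁ e₂))) n≤k

    go : f ≺ h
    go with n γ.≤? m | m γ.≤? n
    ... | yes n≤m | yes m≤n =
      build m (ℤ.<-trans f<g (subst₂ _<ℤ_ (fun-cong g n≈m) (fun-cong h n≈m) g<h))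
            γ.refl n≤m
      where n≈m = γ.antisym n≤m m≤n
    ... | yes n≤m | no m≰n =
      build m (subst (fun f m <ℤ_) (agree g h N m≰n) f<g) γ.refl n≤m
    ... | no n≰m | yes m≤n =
      build n (subst (_<ℤ fun h n) (sym (agree f g M n≰m)) g<h) m≤n γ.refl
    ... | no n≰m | no m≰n with γ.total m n
    ...   | inj₁ m≤n = ⊥-elim (m≰n m≤n)
    ...   | inj₂ n≤m = ⊥-elim (n≰m n≤m)

  ≺-asym : ∀ {f g} → f ≺ g → ¬ (g ≺ f)
  ≺-asym {f} {g} f≺g g≺f =
    ≺-irrefl {f} {f} (λ _ → refl) (≺-trans {f} {g} {f} f≺g g≺f)

  ≺-compare : Trichotomous _≈_ _≺_
  ≺-compare f g with maxDiff f g
  ... | inj₂ f≈g = tri≈ (≺-irrefl {f} {g} f≈g) f≈g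
                        (≺-irrefl {g} {f} (λ β → sym (f≈g β)))
  ... | inj₁ (m , M@((_ , ne) , _)) with ℤ.<-cmp (fun f m) (fun g m)
  ...   | tri< f<g _ _ = tri< f≺g (λ e → ne (e m)) (≺-asym {f} {g} f≺g)
    where f≺g = m , M , f<g
  ...   | tri≈ _ e _ = ⊥-elim (ne e)
  ...   | tri> _ _ g<f = tri> (≺-asym {g} {f} g≺f) (λ e → ne (e m)) g≺f
    where g≺f = m , isMax-sym {f} {g} M , g<f

  ≺-isStrictTotalOrder : IsStrictTotalOrder _≈_ _≺_
  ≺-isStrictTotalOrder = isStrictTotalOrderᶜ record
    { isEquivalence = ≈-isEquivalence
    ; trans         = λ {f} {g} {h} → ≺-trans {f} {g} {h}
    ; compare       = ≺-compare
    }

  ≤-isDecTotalOrder : IsDecTotalOrder _≈_ _≤_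
  ≤-isDecTotalOrder = ToNonStrict.isDecTotalOrder _≈_ _≺_ ≺-isStrictTotalOrder

ℤ^_ : Ordinal a b c → LinearOrder (a ⊔ b) a (a ⊔ c)
ℤ^ γ = record
  { decTotalOrder = record { isDecTotalOrder = ≤-isDecTotalOrder }
  ; point = record
      { fun      = λ _ → 0ℤ
      ; fun-cong = λ _ → refl
      ; finite   = [] , λ 0≢0 → ⊥-elim (0≢0 refl)
      }
  }
  where open Power γ

{-# OPTIONS --safe #-}
module Submission where

-- Under pointwise addition, the lexicographic power of ℤ is a totally ordered
-- abelian group. Given embeddings f of K and g of K′ into it, the map
-- (x , k) ↦ f k + g x embeds the convex sum of a family of convex subsets of
-- K′. If k₀ < k₁, then x₀ ≤ x₁ for all x₀ in the part of k₀ and x₁ in the part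
-- of k₁, so that f k₀ + g x₀ < f k₁ + g x₁ (+-mono-<-≤). Inside a single part,
-- x₀ < x₁ gives f k + g x₀ < f k + g x₁ (+-mono-≤-<). The map is therefore
-- strictly increasing, and a strictly increasing map out of a total order is
-- an embedding.

open import Defs

open import Data.Integer.Base using (0ℤ) renaming (_+_ to _+ℤ_)
import Data.Integer.Properties as ℤ
open import Algebra.Properties.AbelianGroup ℤ.+-0-abelianGroup using (∙-cancelˡ)
open import Data.List.Base using (_++_)
import Data.List.Membership.Setoid as Membership
open import Data.List.Membership.Setoid.Properties using (∈-++⁺ˡ; ∈-++⁺ʳ)
open import Data.Product.Base using (_,_; proj₁; proj₂)
open import Data.Sum.Base using (inj₁; inj₂)
open import Function.Base using (_∘_)
open import Function.Bundles using (mk⇔; module Equivalence)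
open import Relation.Binary.Bundles using (DecTotalOrder)
open import Relation.Binary.PropositionalEquality
  using (_≢_; cong; cong₂)
open import Relation.Nullary using (yes; no; contradiction)
open import Relation.Unary using (_∈_)

open Equivalence using (to; from)

≼-trans : ∀ {a b c a′ b′ c′ a″ b″ c″}
          {L : LinearOrder a b c} {M : LinearOrder a′ b′ c′}
          {N : LinearOrder a″ b″ c″} → L ≼ M → M ≼ N → L ≼ N
≼-trans (f , f-emb) (g , g-emb) = (g ∘ f) , λ x y →
  mk⇔ (to (g-emb (f x) (f y)) ∘ to (f-emb x y))
      (from (f-emb x y) ∘ from (g-emb (f x) (f y)))

module _ {a b c a′ b′ c′} (L : LinearOrder a b c) (L′ : LinearOrder a′ b′ c′) where
  private module L = LinearOrder L
          module L′ = LinearOrder L′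

  strictlyIncreasing⇒≼ : (f : L.Carrier → L′.Carrier) →
                         (∀ {x y} → x L.≈ y → f x L′.≈ f y) →
                         (∀ {x y} → x L.< y → f x L′.< f y) → L ≼ L′
  strictlyIncreasing⇒≼ f f-cong f-mono = f , λ x y → mk⇔ preserves reflects
    where
    preserves : ∀ {x y} → x L.≤ y → f x L′.≤ f y
    preserves {x} {y} x≤y with x L.≟ y
    ... | yes x≈y = L′.reflexive (f-cong x≈y)
    ... | no  x≉y = proj₁ (f-mono (x≤y , x≉y))

    reflects : ∀ {x y} → f x L′.≤ f y → x L.≤ y
    reflects {x} {y} fx≤fy with L.total x y | x L.≟ y
    ... | inj₁ x≤y | _       = x≤y
    ... | inj₂ _   | yes x≈y = L.reflexive x≈y
    ... | inj₂ y≤x | no  x≉y = contradiction (L′.antisym (proj₁ fy<fx) fx≤fy) (proj₂ fy<fx)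
      where fy<fx = f-mono (y≤x , x≉y ∘ L.Eq.sym)

  module _ (e : L ≼ L′) where
    private f = proj₁ e

    embedding-mono : ∀ {x y} → x L.≤ y → f x L′.≤ f y
    embedding-mono {x} {y} = to (proj₂ e x y)

    embedding-cong : ∀ {x y} → x L.≈ y → f x L′.≈ f y
    embedding-cong x≈y = L′.antisym (embedding-mono (L.reflexive x≈y))
                                    (embedding-mono (L.reflexive (L.Eq.sym x≈y)))

    embedding-mono-< : ∀ {x y} → x L.< y → f x L′.< f y
    embedding-mono-< {x} {y} (x≤y , x≉y) = embedding-mono x≤y , λ fx≈fy →
      x≉y (L.antisym x≤y (from (proj₂ e y x) (L′.reflexive (L′.Eq.sym fx≈fy))))

module OrderedGroup {a b c} (γ : Ordinal a b c) where
  open Power γ using (FinSupp; fun; fun-cong; finite; Diff; differ)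
  open LinearOrder (ℤ^ γ) using (_≈_; _≤_; _<_; poset)
  private module γ = DecTotalOrder (Ordinal.decTotalOrder γ)
  open Membership γ.Eq.setoid using () renaming (_∈_ to _∈ᴸ_)

  infixl 6 _+_

  -- Pointwise addition; the support of a sum is covered by the supports of
  -- the two summands.
  _+_ : FinSupp → FinSupp → FinSupp
  f + g = record
    { fun      = λ β → fun f β +ℤ fun g β
    ; fun-cong = λ α≈β → cong₂ _+ℤ_ (fun-cong f α≈β) (fun-cong g α≈β)
    ; finite   = proj₁ (finite f) ++ proj₁ (finite g) , listed
    }
    where
    listed : ∀ {β} → fun f β +ℤ fun g β ≢ 0ℤ →
             β ∈ᴸ proj₁ (finite f) ++ proj₁ (finite g)
    listed {β} f+g≢0 with fun f β ℤ.≟ 0ℤ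
    ... | no  f≢0 = ∈-++⁺ˡ γ.Eq.setoid (proj₂ (finite f) f≢0)
    ... | yes f≡0 = ∈-++⁺ʳ γ.Eq.setoid (proj₁ (finite f))
      (proj₂ (finite g) λ g≡0 → f+g≢0 (cong₂ _+ℤ_ f≡0 g≡0))

  +-cong : ∀ {f f′ g g′} → f ≈ f′ → g ≈ g′ → f + g ≈ f′ + g′
  +-cong f≈f′ g≈g′ β = cong₂ _+ℤ_ (f≈f′ β) (g≈g′ β)

  +-comm : ∀ f g → f + g ≈ g + f
  +-comm f g β = ℤ.+-comm (fun f β) (fun g β)

  +-cancelˡ : ∀ h {f g} → h + f ≈ h + g → f ≈ g
  +-cancelˡ h {f} {g} eq β = ∙-cancelˡ (fun h β) (fun f β) (fun g β) (eq β)

  -- By cancellation, adding h does not change the set of positions where f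
  -- and g differ, hence not its maximum either.
  +-monoʳ-≤ : ∀ h {f g} → f ≤ g → h + f ≤ h + g
  +-monoʳ-≤ h {f} {g} (inj₂ f≈g) = inj₂ λ β → cong (fun h β +ℤ_) (f≈g β)
  +-monoʳ-≤ h {f} {g} (inj₁ (m , ((_ , f≢g) , max) , f<g)) =
    inj₁ (m , (differ (h + f) (h + g) (f≢g ∘ ∙-cancelˡ (fun h m) _ _) , bound)
            , ℤ.+-monoʳ-< (fun h m) f<g)
    where
    bound : ∀ {β} → β ∈ Diff (h + f) (h + g) → β γ.≤ m
    bound {β} (_ , ne) = max (differ f g (ne ∘ cong (fun h β +ℤ_)))

  +-monoʳ-< : ∀ h {f g} → f < g → h + f < h + g
  +-monoʳ-< h {f} {g} (f≤g , f≉g) =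
    +-monoʳ-≤ h {f} {g} f≤g , f≉g ∘ +-cancelˡ h {f} {g}

  open import Relation.Binary.Reasoning.PartialOrder poset

  +-mono-≤-< : ∀ {f f′ g g′} → f ≤ f′ → g < g′ → f + g < f′ + g′
  +-mono-≤-< {f} {f′} {g} {g′} f≤f′ g<g′ = begin-strict
    f + g    ≈⟨ +-comm f g ⟩
    g + f    ≤⟨ +-monoʳ-≤ g {f} {f′} f≤f′ ⟩
    g + f′   ≈⟨ +-comm g f′ ⟩
    f′ + g   <⟨ +-monoʳ-< f′ {g} {g′} g<g′ ⟩
    f′ + g′  ∎

  +-mono-<-≤ : ∀ {f f′ g g′} → f < f′ → g ≤ g′ → f + g < f′ + g′
  +-mono-<-≤ {f} {f′} {g} {g′} f<f′ g≤g′ = begin-strict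
    f + g    ≈⟨ +-comm f g ⟩
    g + f    <⟨ +-mono-≤-< {g} {g′} {f} {f′} g≤g′ f<f′ ⟩
    g′ + f′  ≈⟨ +-comm g′ f′ ⟩
    f′ + g′  ∎

module _ {a b c ℓ} (γ : Ordinal a b c) {K K′ : LinearOrder ℓ ℓ ℓ}
         (F : ConvexFamily K K′) where
  open OrderedGroup γ
  open ConvexFamily F using (increasing)
  private module K = LinearOrder K
          module K′ = LinearOrder K′
          module S = LinearOrder (convexSum K K′ F)
          module P = LinearOrder (ℤ^ γ)

  convexSum-≼ : K ≼ ℤ^ γ → K′ ≼ ℤ^ γ → convexSum K K′ F ≼ ℤ^ γ
  convexSum-≼ f-emb@(f , _) g-emb@(g , _) =
    strictlyIncreasing⇒≼ (convexSum K K′ F) (ℤ^ γ) h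
      (λ {s} {t} → h-cong {s} {t}) (λ {s} {t} → h-mono {s} {t})
    where
    h : S.Carrier → P.Carrier
    h ((x , k) , _) = f k + g x

    h-cong : ∀ {s t} → s S.≈ t → h s P.≈ h t
    h-cong {(x₀ , k₀) , _} {(x₁ , k₁) , _} (k₀≈k₁ , x₀≈x₁) =
      +-cong {f k₀} {f k₁} {g x₀} {g x₁}
        (embedding-cong K (ℤ^ γ) f-emb k₀≈k₁)
        (embedding-cong K′ (ℤ^ γ) g-emb x₀≈x₁)

    h-mono : ∀ {s t} → s S.< t → h s P.< h t
    h-mono {(x₀ , k₀) , x₀∈} {(x₁ , k₁) , x₁∈} (inj₁ k₀<k₁ , _) =
      +-mono-<-≤ {f k₀} {f k₁} {g x₀} {g x₁}
        (embedding-mono-< K (ℤ^ γ) f-emb k₀<k₁)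
        (embedding-mono K′ (ℤ^ γ) g-emb (increasing k₀<k₁ x₀∈ x₁∈))
    h-mono {(x₀ , k₀) , _} {(x₁ , k₁) , _} (inj₂ (k₀≈k₁ , x₀≤x₁) , s≉t) =
      +-mono-≤-< {f k₀} {f k₁} {g x₀} {g x₁}
        (embedding-mono K (ℤ^ γ) f-emb (K.reflexive k₀≈k₁))
        (embedding-mono-< K′ (ℤ^ γ) g-emb (x₀≤x₁ , λ x₀≈x₁ → s≉t (k₀≈k₁ , x₀≈x₁)))

proposition7p6 : ∀ {a b c ℓ} (γ : Ordinal a b c) → Countable γ → IsCCS {ℓ} (𝓛≼ (ℤ^ γ))
proposition7p6 γ _ = record
  { downward = λ {L} {L′} → ≼-trans {L = L} {L′} {ℤ^ γ}
  ; sums     = λ K≼ K′≼ F → convexSum-≼ γ F K≼ K′≼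
  }
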